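{- There is an explicit polynomial $Q$ in $n$ variables and of degree at most $n/2$ such that any $\Sigma\Pi\Sigma$ circuit of product dimension at most $n/10$ computing $Q$ has size $2^{\Omega(n)}$.
   Context: Let $\mathbb{F}$ be a field. A $\Sigma\Pi\Sigma$ circuit is a levelled depth-3 arithmetic circuit computing $\sum_{j=1}^k P^j$ where each $P^j=\prod_{i=1}^{s_j}L^j_i$ is a product of affine forms $L^j_i$ over $\mathbb{F}$ (outputs of bottom plus gates); $k$ is the top fan-in and the size is the number of gates. The circuit has product dimension $r$ if for each product gate $P^j=\prod_i L^j_i$ the dimension of the linear span of $\{L^j_i\}_i$ is at most $r$. -}

module Defs where

open import Algebra.Apartness.Bundles using (HeytingField; HeytingCommutativeRing)
open import Algebra.Bundles using (CommutativeRing)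
import Algebra.Definitions.RawMonoid as RawMonoidSum
open import Data.Bool.Base using (Bool; false; true; if_then_else_)
open import Data.Fin.Base using (Fin; zero; suc; splitAt)
open import Data.List.Base using (List; []; _∷_; _++_; cartesianProductWith)
import Data.List.Base as List
open import Data.Nat.Base using (ℕ; zero; suc; _≤_; _<_) renaming (_+_ to _+ℕ_; _^_ to _^ℕ_)
import Data.Nat.Properties as ℕₚ
open import Data.Product.Base using (_×_; _,_; ∃-syntax)
open import Data.Sum.Base using ([_,_]′)
open import Data.Vec.Base as Vec using (Vec; []; _∷_)
import Data.Vec.Properties as Vecₚ
open import Data.Vec.Functional using (Vector; foldr)
open import Function.Base using (_∘_)
open import Level using (_⊔_)
open import Relation.Nullary.Decidable.Core using (does)

-- Straight-line arithmetic circuits in v variables whose only constants are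
-- 0, 1 and -1.  The index counts gates; a gate refers to earlier gates by
-- de Bruijn index, 0 being the gate added immediately before it.

data Gate (v g : ℕ) : Set where
  input             : Fin v → Gate v g
  zero one minusOne : Gate v g
  add mul           : Fin g → Fin g → Gate v g

data ConstantFreeCircuit (v : ℕ) : ℕ → Set where
  []  : ConstantFreeCircuit v 0
  _▷_ : ∀ {g} → ConstantFreeCircuit v g → Gate v g → ConstantFreeCircuit v (suc g)

module _ {c ℓ₁ ℓ₂} (F : HeytingField c ℓ₁ ℓ₂) where

  private
    module R = CommutativeRing
      (HeytingCommutativeRing.commutativeRing (HeytingField.heytingCommutativeRing F))
  open R using (Carrier; _≈_; 0#; 1#; _+_; _*_; -_)
  open RawMonoidSum R.+-rawMonoid using (sum)

  -- Formal polynomials: a list of terms (coefficient , exponent vector), in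
  -- which a monomial may occur several times.  Equality is _≋_, equality of
  -- all coefficients, not equality of lists or of polynomial functions.

  Poly : ℕ → Set c
  Poly n = List (Carrier × Vec ℕ n)

  coeff : ∀ {n} → Poly n → Vec ℕ n → Carrier
  coeff []            m = 0#
  coeff ((a , e) ∷ p) m =
    (if does (Vecₚ.≡-dec ℕₚ._≟_ e m) then a else 0#) + coeff p m

  infix 4 _≋_
  _≋_ : ∀ {n} → Poly n → Poly n → Set ℓ₁
  p ≋ q = ∀ m → coeff p m ≈ coeff q m

  DegreeAtMost : ∀ {n} → Poly n → ℕ → Set ℓ₁
  DegreeAtMost p d = ∀ m → d < Vec.sum m → coeff p m ≈ 0#

  const : ∀ {n} → Carrier → Poly n
  const {n} a = (a , Vec.replicate n 0) ∷ []

  unitExponent : ∀ {n} → Fin n → Vec ℕ n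
  unitExponent {n} i = Vec.replicate n 0 Vec.[ i ]≔ 1

  var : ∀ {n} → Fin n → Poly n
  var i = (1# , unitExponent i) ∷ []

  infixl 6 _⊕_
  infixl 7 _⊗_

  _⊕_ : ∀ {n} → Poly n → Poly n → Poly n
  _⊕_ = _++_

  _⊗_ : ∀ {n} → Poly n → Poly n → Poly n
  _⊗_ = cartesianProductWith λ { (a , e) (b , f) → a * b , Vec.zipWith _+ℕ_ e f }

  -- Finite-dimensional linear algebra in F^N.

  linComb : ∀ {d N} → Vector Carrier d → Vector (Vector Carrier N) d → Vector Carrier N
  linComb a v t = sum λ i → a i * v i t

  _∈Span_ : ∀ {d N} → Vector Carrier N → Vector (Vector Carrier N) d → Set (c ⊔ ℓ₁)
  w ∈Span v = ∃[ a ] (∀ t → w t ≈ linComb a v t)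

  LinearlyIndependent : ∀ {d N} → Vector (Vector Carrier N) d → Set (c ⊔ ℓ₁)
  LinearlyIndependent v = ∀ a → (∀ t → linComb a v t ≈ 0#) → ∀ i → a i ≈ 0#

  record IsBasisOfSpan {d s N} (b : Vector (Vector Carrier N) d)
                       (v : Vector (Vector Carrier N) s) : Set (c ⊔ ℓ₁) where
    field
      inSpan      : ∀ i → b i ∈Span v
      independent : LinearlyIndependent b
      spanning    : ∀ i → v i ∈Span b

  SpanDimension≤ : ∀ {s N} → Vector (Vector Carrier N) s → ℕ → Set (c ⊔ ℓ₁)
  SpanDimension≤ {N = N} v r =
    ∃[ d ] d ≤ r × ∃[ b ] IsBasisOfSpan {d} {N = N} b v

  -- The affine form a₀ + a₁x₁ + … + aₙxₙ is the vector (a₀ , a₁ , … , aₙ), so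
  -- the constant term counts towards the dimension of a span.

  AffineForm : ℕ → Set c
  AffineForm n = Vector Carrier (suc n)

  affinePoly : ∀ {n} → AffineForm n → Poly n
  affinePoly {n} a =
    (a zero , Vec.replicate n 0)
    ∷ List.map (λ i → a (suc i) , unitExponent i) (List.allFin n)

  -- Bottom gates may be shared between product gates, and may feed the same
  -- product gate several times (so powers of affine forms are allowed).

  record ΣΠΣCircuit (n : ℕ) : Set c where
    field
      bottomGates : ℕ
      form        : Fin bottomGates → AffineForm n
      topFanIn    : ℕ
      fanIn       : Fin topFanIn → ℕ
      wire        : (j : Fin topFanIn) → Fin (fanIn j) → Fin bottomGates

    factors : (j : Fin topFanIn) → Vector (AffineForm n) (fanIn j)
    factors j i = form (wire j i)

    productGate : Fin topFanIn → Poly n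
    productGate j = foldr _⊗_ (const 1#) (affinePoly ∘ factors j)

    output : Poly n
    output = foldr _⊕_ [] productGate

    -- The output gate, the product gates and the bottom gates.
    size : ℕ
    size = 1 +ℕ topFanIn +ℕ bottomGates

  Computes : ∀ {n} → ΣΠΣCircuit n → Poly n → Set ℓ₁
  Computes C q = ΣΠΣCircuit.output C ≋ q

  ProductDimension≤ : ∀ {n} → ΣΠΣCircuit n → ℕ → Set (c ⊔ ℓ₁)
  ProductDimension≤ C r = ∀ j → SpanDimension≤ (ΣΠΣCircuit.factors C j) r

  gateValue : ∀ {n v g} → (Fin v → Poly n) → Vec (Poly n) g → Gate v g → Poly n
  gateValue ρ vs (input x) = ρ x
  gateValue ρ vs zero      = const 0#
  gateValue ρ vs one       = const 1#
  gateValue ρ vs minusOne  = const (- 1#)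
  gateValue ρ vs (add x y) = Vec.lookup vs x ⊕ Vec.lookup vs y
  gateValue ρ vs (mul x y) = Vec.lookup vs x ⊗ Vec.lookup vs y

  gateValues : ∀ {n v g} → (Fin v → Poly n) → ConstantFreeCircuit v g → Vec (Poly n) g
  gateValues ρ []      = []
  gateValues ρ (C ▷ γ) = gateValue ρ vs γ ∷ vs
    where vs = gateValues ρ C

  value : ∀ {n v g} → (Fin v → Poly n) → ConstantFreeCircuit v (suc g) → Poly n
  value ρ C = Vec.head (gateValues ρ C)

  sumCube : ∀ {n} m → (Vec Bool m → Poly n) → Poly n
  sumCube zero    f = f []
  sumCube (suc m) f = sumCube m (f ∘ (false ∷_)) ⊕ sumCube m (f ∘ (true ∷_))

  substituteBits : ∀ {n m} → Vec Bool m → Fin (n +ℕ m) → Poly n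
  substituteBits {n} e i =
    [ var , (λ j → const (if Vec.lookup e j then 1# else 0#)) ]′ (splitAt n i)

  -- "Explicit" in the usual sense of algebraic complexity, membership in VNP:
  --   Qₙ(x) = Σ_{e ∈ {0,1}^m} gₙ(x , e),
  -- where m, the degree of gₙ and the size of a circuit for gₙ are polynomially
  -- bounded in n.  The circuits are moreover constant-free, so that no
  -- information can be hidden in the choice of field constants.

  record Explicit (Q : ∀ n → Poly n) : Set ℓ₁ where
    field
      exponent : ℕ
      auxVars  : ℕ → ℕ
      gates    : ℕ → ℕ
      circuit  : ∀ n → ConstantFreeCircuit (n +ℕ auxVars n) (suc (gates n))

    bound : ℕ → ℕ
    bound n = n ^ℕ exponent +ℕ exponent

    field
      auxVars≤bound : ∀ n → auxVars n ≤ bound n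
      gates≤bound   : ∀ n → suc (gates n) ≤ bound n
      degree≤bound  : ∀ n → DegreeAtMost (value var (circuit n)) (bound n)
      sums-to       : ∀ n → Q n ≋ sumCube (auxVars n) λ e →
                                    value (substituteBits e) (circuit n)

-- Let m = n/10 and Q = ∏_{i<m} Σ_{j<5} y_ij z_ij, a product of m inner products in disjoint
-- variables.  Give y_ij and z_ij the weight j 5^i and substitute y_ij ↦ s q^(j 5^i),
-- z_ij ↦ r^(j 5^i): then Q becomes s^m Σ_{c<5^m} q^c r^c, whose
-- coefficient matrix in (q , r) is the identity matrix of size 5^m.
--
-- A product of affine forms from the span of d ≤ m forms b₁ , … , b_d becomes a product of
-- terms λ s + μ with λ in the span of the s-parts λ₁ , … , λ_d ∈ F[q] of the bᵢ and μ ∈ F[r].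
-- Its part of degree m in s is Σ_α λ^α g_α(r), summed over monomials α of degree m in
-- d variables; there are at most 2^(d+m) ≤ 4^m of these, which bounds the rank of the
-- coefficient matrix.  With k product gates this gives 5^m ≤ k 4^m.
--
-- Matrices are handled through functionals: one looks for a functional u on F[q]_{<5^m}
-- killing every λ^α of every gate; it would then be killed by the identity matrix.

module Submission where

open import Defs
open import Algebra.Apartness.Bundles using (HeytingField; HeytingCommutativeRing)
import Algebra.Apartness.Properties.HeytingCommutativeRing as HeytingCommutativeRingProperties
open import Algebra.Bundles using (CommutativeRing)
import Algebra.Properties.CommutativeSemigroup as CommutativeSemigroupProperties
open import Data.Bool.Base using (Bool; true; false; if_then_else_)
open import Data.Empty using (⊥-elim)
open import Data.Fin.Base using (Fin; zero; suc; toℕ; fromℕ<; punchIn; splitAt; _↑ˡ_; _↑ʳ_)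
import Data.Fin.Properties as Finₚ
open import Data.List.Base as List using (List; []; _∷_; _++_)
open import Data.List.Membership.Propositional using (_∈_; _∉_)
open import Data.List.Membership.Propositional.Properties using (∈-deduplicate⁺; ∈-++⁺ˡ; ∈-++⁺ʳ)
open import Data.List.Relation.Unary.All as All using (All; []; _∷_)
import Data.List.Relation.Unary.All.Properties as Allₚ
open import Data.List.Relation.Unary.AllPairs using ([]; _∷_)
open import Data.List.Relation.Unary.Any using (here; there)
open import Data.List.Relation.Unary.Unique.Propositional using (Unique)
import Data.List.Relation.Unary.Unique.DecPropositional.Properties as UniqueDec
open import Data.Nat as ℕ using (ℕ; zero; suc; _≤_; _<_; z≤n; s≤s; _≤?_; _≡ᵇ_; _<ᵇ_)
open import Data.Nat.DivMod using (_/_; _%_)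
import Data.Nat.DivMod as DivMod
import Data.Nat.Properties as ℕₚ
open import Data.Nat.Tactic.RingSolver using (solve-∀)
open import Data.Product using (Σ-syntax; ∃-syntax; _×_; _,_; proj₁; proj₂)
open import Data.Sum.Base using (inj₁)
open import Data.Unit.Polymorphic using (⊤; tt)
open import Data.Vec.Base as Vec using (Vec; []; _∷_)
open import Data.Vec.Functional as Vector using (Vector; foldr; insertAt)
open import Data.Vec.Functional.Properties
  using (insertAt-lookup; insertAt-punchIn; lookup-++ˡ; lookup-++ʳ)
import Data.Vec.Properties as Vecₚ
open import Function.Base using (_∘_; id)
open import Level using (_⊔_)
open import Relation.Binary.PropositionalEquality as ≡ using (_≡_)
import Relation.Binary.Reasoning.Setoid as SetoidReasoning
open import Relation.Nullary.Decidable
  using (yes; no; does; dec-true; dec-false; decidable-stable; ¬¬-excluded-middle)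
open import Relation.Nullary.Negation using (contradiction)

-- Exponent vectors, their weights and degrees.

infixl 6 _+ᵉ_
_+ᵉ_ : ∀ {n} → Vec ℕ n → Vec ℕ n → Vec ℕ n
_+ᵉ_ = Vec.zipWith ℕ._+_

𝟎 : ∀ {n} → Vec ℕ n
𝟎 {n} = Vec.replicate n 0

𝟎-identityˡ : ∀ {n} (e : Vec ℕ n) → 𝟎 +ᵉ e ≡ e
𝟎-identityˡ = Vecₚ.zipWith-identityˡ λ _ → ≡.refl

weigh : ∀ {n} → (Fin n → ℕ) → Vec ℕ n → ℕ
weigh w []      = 0
weigh w (x ∷ e) = x ℕ.* w zero ℕ.+ weigh (w ∘ suc) e

weigh-+ : ∀ {n} w (e f : Vec ℕ n) → weigh w (e +ᵉ f) ≡ weigh w e ℕ.+ weigh w f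
weigh-+ w []      []      = ≡.refl
weigh-+ w (x ∷ e) (y ∷ f) = begin
  (x ℕ.+ y) ℕ.* w zero ℕ.+ weigh (w ∘ suc) (e +ᵉ f)
    ≡⟨ ≡.cong₂ ℕ._+_ (ℕₚ.*-distribʳ-+ (w zero) x y) (weigh-+ (w ∘ suc) e f) ⟩
  (x ℕ.* w zero ℕ.+ y ℕ.* w zero) ℕ.+ (weigh (w ∘ suc) e ℕ.+ weigh (w ∘ suc) f)
    ≡⟨ interchange (x ℕ.* w zero) _ _ _ ⟩
  weigh w (x ∷ e) ℕ.+ weigh w (y ∷ f) ∎
  where
  open ≡.≡-Reasoning
  open CommutativeSemigroupProperties ℕₚ.+-commutativeSemigroup using (interchange)

weigh-𝟎 : ∀ {n} (w : Fin n → ℕ) → weigh w 𝟎 ≡ 0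
weigh-𝟎 {zero}  w = ≡.refl
weigh-𝟎 {suc n} w = weigh-𝟎 (w ∘ suc)

weigh-unit : ∀ {n} (w : Fin n → ℕ) t → weigh w (𝟎 Vec.[ t ]≔ 1) ≡ w t
weigh-unit w zero    = ≡.trans (≡.cong₂ ℕ._+_ (ℕₚ.*-identityˡ (w zero)) (weigh-𝟎 (w ∘ suc)))
                               (ℕₚ.+-identityʳ (w zero))
weigh-unit w (suc t) = weigh-unit (w ∘ suc) t

weigh-shift : ∀ {n} (w : Fin n → ℕ) t e → weigh w ((𝟎 Vec.[ t ]≔ 1) +ᵉ e) ≡ w t ℕ.+ weigh w e
weigh-shift w t e = ≡.trans (weigh-+ w (𝟎 Vec.[ t ]≔ 1) e) (≡.cong (ℕ._+ weigh w e) (weigh-unit w t))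

sum-+ᵉ : ∀ {k} (e f : Vec ℕ k) → Vec.sum (e +ᵉ f) ≡ Vec.sum e ℕ.+ Vec.sum f
sum-+ᵉ []      []      = ≡.refl
sum-+ᵉ (x ∷ e) (y ∷ f) = ≡.trans (≡.cong (x ℕ.+ y ℕ.+_) (sum-+ᵉ e f)) (interchange x y _ _)
  where open CommutativeSemigroupProperties ℕₚ.+-commutativeSemigroup using (interchange)

sum-𝟎 : ∀ k → Vec.sum (𝟎 {k}) ≡ 0
sum-𝟎 zero    = ≡.refl
sum-𝟎 (suc k) = sum-𝟎 k

sum-unit : ∀ {k} (t : Fin k) → Vec.sum (𝟎 Vec.[ t ]≔ 1) ≡ 1
sum-unit {suc k} zero = ≡.cong suc (sum-𝟎 k)
sum-unit (suc t)      = sum-unit t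

-- The circuit for the product of inner products, and the layout of its variables.

addProducts : ∀ {v g s} → (Fin s → Fin v) → (Fin s → Fin v) →
              ConstantFreeCircuit v (suc g) → ConstantFreeCircuit v (suc (s ℕ.* 4 ℕ.+ g))
addProducts {s = zero}  y z C = C
addProducts {s = suc s} y z C =
  -- The running sum is always the last gate. Index 3 in the final `add` skips the new product and
  -- its two inputs to reach it.
  (((addProducts (y ∘ suc) (z ∘ suc) C ▷ input (y zero)) ▷ input (z zero))
    ▷ mul (suc zero) zero) ▷ add zero (3 ↑ʳ zero)

-- The sum starts from a fresh `zero` gate and takes 5 · 4 further gates. Index 21 skips these 21
-- gates and reaches the last gate of `C`.
multiplyByInnerProduct : ∀ {v g} → (Fin 5 → Fin v) → (Fin 5 → Fin v) →
                         ConstantFreeCircuit v (suc g) → ConstantFreeCircuit v (suc (22 ℕ.+ g))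
multiplyByInnerProduct y z C = addProducts y z (C ▷ zero) ▷ mul zero (21 ↑ʳ zero)

-- Block i occupies the variables 10i, ..., 10i + 9: first the five y's, then the five z's.
slot : ∀ {n} i → suc i ℕ.* 10 ≤ n → Fin 10 → Fin n
slot i i<n j = fromℕ< (ℕₚ.≤-trans (ℕₚ.+-monoˡ-< (i ℕ.* 10) (Finₚ.toℕ<n j)) i<n)

ySlot zSlot : ∀ {n} i → suc i ℕ.* 10 ≤ n → Fin 5 → Fin n
ySlot i i<n j = slot i i<n (j ↑ˡ 5)
zSlot i i<n j = slot i i<n (5 ↑ʳ j)

*10-weaken : ∀ {n} m → suc m ℕ.* 10 ≤ n → m ℕ.* 10 ≤ n
*10-weaken m = ℕₚ.≤-trans (ℕₚ.m≤n+m (m ℕ.* 10) 10)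

circuit : ∀ {v n} → (Fin n → Fin v) → ∀ m → m ℕ.* 10 ≤ n →
          ConstantFreeCircuit v (suc (m ℕ.* 22))
circuit ι zero    m≤n = [] ▷ one
circuit ι (suc m) m<n = multiplyByInnerProduct (ι ∘ ySlot m m<n) (ι ∘ zSlot m m<n)
                          (circuit ι m (*10-weaken m m<n))

isYVariable : ∀ {n} → Fin n → Bool
isYVariable t = toℕ t % 10 <ᵇ 5

-- The variables in slot j of block i, of either kind, get weight j 5^i, so that the
-- multilinear monomials with one variable from each block are numbered in base 5.
base5Weight : ∀ {n} → Fin n → ℕ
base5Weight t = (toℕ t % 10 % 5) ℕ.* 5 ℕ.^ (toℕ t / 10)

module _ {n} i (i<n : suc i ℕ.* 10 ≤ n) (j : Fin 10) where

  private
    toℕ-slot : toℕ (slot i i<n j) ≡ toℕ j ℕ.+ i ℕ.* 10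
    toℕ-slot = Finₚ.toℕ-fromℕ< _

  slot-% : toℕ (slot i i<n j) % 10 ≡ toℕ j
  slot-% = ≡.trans (≡.cong (_% 10) toℕ-slot)
    (≡.trans (DivMod.[m+kn]%n≡m%n (toℕ j) i 10) (DivMod.m<n⇒m%n≡m (Finₚ.toℕ<n j)))

  -- Uniqueness of division with remainder: `slot-%` gives the remainder, so it cancels, and then so
  -- does the factor 10.
  slot-/ : toℕ (slot i i<n j) / 10 ≡ i
  slot-/ = ℕₚ.*-cancelʳ-≡ (toℕ t / 10) i 10 (ℕₚ.+-cancelˡ-≡ (toℕ j) _ _ (≡.trans
    (≡.cong (ℕ._+ toℕ t / 10 ℕ.* 10) (≡.sym slot-%))
    (≡.trans (≡.sym (DivMod.m≡m%n+[m/n]*n (toℕ t) 10)) toℕ-slot)))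
    where t = slot i i<n j

  isYVariable-slot : isYVariable (slot i i<n j) ≡ (toℕ j <ᵇ 5)
  isYVariable-slot = ≡.cong (_<ᵇ 5) slot-%

  base5Weight-slot : base5Weight (slot i i<n j) ≡ (toℕ j % 5) ℕ.* 5 ℕ.^ i
  base5Weight-slot = ≡.cong₂ (λ r q → (r % 5) ℕ.* 5 ℕ.^ q) slot-% slot-/

module _ {n} i (i<n : suc i ℕ.* 10 ≤ n) (j : Fin 5) where

  ySlot-isY : isYVariable (ySlot i i<n j) ≡ true
  ySlot-isY = ≡.trans (isYVariable-slot i i<n (j ↑ˡ 5)) (dec-true (toℕ (j ↑ˡ 5) ℕₚ.<? 5)
    (≡.subst (_< 5) (≡.sym (Finₚ.toℕ-↑ˡ j 5)) (Finₚ.toℕ<n j)))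

  zSlot-isY : isYVariable (zSlot i i<n j) ≡ false
  zSlot-isY = isYVariable-slot i i<n (5 ↑ʳ j)

  ySlot-weight : base5Weight (ySlot i i<n j) ≡ toℕ j ℕ.* 5 ℕ.^ i
  ySlot-weight = ≡.trans (base5Weight-slot i i<n (j ↑ˡ 5)) (≡.cong (ℕ._* 5 ℕ.^ i)
    (≡.trans (≡.cong (_% 5) (Finₚ.toℕ-↑ˡ j 5)) (DivMod.m<n⇒m%n≡m (Finₚ.toℕ<n j))))

  zSlot-weight : base5Weight (zSlot i i<n j) ≡ toℕ j ℕ.* 5 ℕ.^ i
  zSlot-weight = ≡.trans (base5Weight-slot i i<n (5 ↑ʳ j)) (≡.cong (ℕ._* 5 ℕ.^ i)
    (DivMod.m<n⇒m%n≡m (Finₚ.toℕ<n j)))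

-- Gates read earlier values by `lookup`, whereas `value` is a `head`. For a circuit that is not in
-- constructor form the two do not reduce to each other.
lookup-zero : ∀ {a} {A : Set a} {n} (xs : Vec A (suc n)) → Vec.lookup xs zero ≡ Vec.head xs
lookup-zero (x ∷ xs) = ≡.refl

module ProductDimension {c ℓ₁ ℓ₂} (F : HeytingField c ℓ₁ ℓ₂) where

  open HeytingField F using (_#_; tight; #⇒invertible; heytingCommutativeRing)
  open HeytingCommutativeRingProperties heytingCommutativeRing using (1#0; x-0≈x)
  open CommutativeRing (HeytingCommutativeRing.commutativeRing heytingCommutativeRing)
    hiding (zero)
  open import Algebra.Properties.Semiring.Sum semiring
  open import Algebra.Properties.Ring ring using (-‿distribˡ-*; -‿distribʳ-*)
  open CommutativeSemigroupProperties +-commutativeSemigroup using (interchange)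
  open CommutativeSemigroupProperties *-commutativeSemigroup using (x∙yz≈y∙xz)
  open SetoidReasoning setoid

  -- Linear equations over a Heyting field.

  dot : ∀ {N} → Vector Carrier N → Vector Carrier N → Carrier
  dot a u = sum λ i → a i * u i

  dot-cong : ∀ {N} {a b u v : Vector Carrier N} →
             (∀ i → a i ≈ b i) → (∀ i → u i ≈ v i) → dot a u ≈ dot b v
  dot-cong a≈b u≈v = sum-cong-≋ λ i → *-cong (a≈b i) (u≈v i)

  sum-zero : ∀ {N} {f : Vector Carrier N} → (∀ i → f i ≈ 0#) → sum f ≈ 0#
  sum-zero {N} f≈0 = trans (sum-cong-≋ f≈0) (sum-replicate-zero N)

  -- Here r is an equation normalised so that r i ≈ 1.
  eliminate : ∀ {M} → Fin (suc M) → Vector Carrier (suc M) →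
              Vector Carrier (suc M) → Vector Carrier M
  eliminate i r s k = s (punchIn i k) - s i * r (punchIn i k)

  -- If `r i ≈ 1#`, the inserted entry is the one that makes `dot r` vanish.
  solveFor : ∀ {M} → Fin (suc M) → Vector Carrier (suc M) →
             Vector Carrier M → Vector Carrier (suc M)
  solveFor i r u = insertAt u i (- dot (r ∘ punchIn i) u)

  -- Both sides are `dot (s ∘ punchIn i) u` minus `s i` times `dot (r ∘ punchIn i) u`.
  dot-solveFor : ∀ {M} i (r s : Vector Carrier (suc M)) u →
                 dot s (solveFor i r u) ≈ dot (eliminate i r s) u
  dot-solveFor {M} i r s u = begin
    dot s (solveFor i r u)                       ≈⟨ sum-remove {i = i} (λ k → s k * solveFor i r u k) ⟩
    s i * solveFor i r u i + dot (s ∘ punchIn i) (solveFor i r u ∘ punchIn i)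
      ≈⟨ +-cong (*-congˡ (reflexive (insertAt-lookup u i _)))
                (dot-cong (λ _ → refl) (λ k → reflexive (insertAt-punchIn u i _ k))) ⟩
    s i * (- ρ) + dot (s ∘ punchIn i) u          ≈⟨ +-comm _ _ ⟩
    dot (s ∘ punchIn i) u + s i * (- ρ)          ≈⟨ +-congˡ lemma ⟩
    dot (s ∘ punchIn i) u + sum (λ k → - (s i * r (punchIn i k)) * u k)
      ≈⟨ ∑-distrib-+ (λ k → s (punchIn i k) * u k) _ ⟨
    sum (λ k → s (punchIn i k) * u k + - (s i * r (punchIn i k)) * u k)
      ≈⟨ sum-cong-≋ {M} (λ k → distribʳ (u k) _ _) ⟨
    dot (eliminate i r s) u                      ∎
    where
    ρ = dot (r ∘ punchIn i) u
    lemma : s i * (- ρ) ≈ sum (λ k → - (s i * r (punchIn i k)) * u k)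
    lemma = begin
      s i * (- ρ)                                   ≈⟨ -‿distribʳ-* _ _ ⟨
      - (s i * ρ)                                   ≈⟨ -‿distribˡ-* _ _ ⟩
      (- s i) * ρ
        ≈⟨ *-distribˡ-sum (- s i) (λ k → r (punchIn i k) * u k) ⟩
      sum (λ k → (- s i) * (r (punchIn i k) * u k))
        ≈⟨ sum-cong-≋ {M} (λ k → trans (sym (*-assoc _ _ _)) (*-congʳ (sym (-‿distribˡ-* _ _)))) ⟩
      sum (λ k → - (s i * r (punchIn i k)) * u k)   ∎

  -- Gaussian elimination, one row at a time. Whether a row has a pivot is not decidable, but
  -- `M ≤ N` is, hence it is stable under double negation and excluded middle may be used to prove
  -- it.
  injective⇒≤ : ∀ {M N} (A : Fin N → Vector Carrier M) →
                (∀ u → (∀ r → dot (A r) u ≈ 0#) → ∀ i → u i ≈ 0#) → M ≤ N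
  injective⇒≤ {zero}          A inj = z≤n
  injective⇒≤ {suc M} {zero}  A inj =
    ⊥-elim (proj₂ (tight 1# 0#) (inj (λ _ → 1#) (λ ()) zero) 1#0)
  injective⇒≤ {suc M} {suc N} A inj = decidable-stable (suc M ≤? suc N) λ M≰N →
    ¬¬-excluded-middle {A = ∃[ i ] A zero i # 0#} λ where
      -- Without a pivot the first row is zero by tightness of the apartness, so dropping it keeps
      -- the system injective.
      (no ∄pivot) → M≰N (ℕₚ.m≤n⇒m≤1+n (injective⇒≤ (A ∘ suc) λ u Au≈0 → inj u λ where
        zero    → sum-zero λ i →
                    trans (*-congʳ (proj₁ (tight _ _) λ Ai#0 → ∄pivot (i , Ai#0))) (zeroˡ (u i))
        (suc r) → Au≈0 r))
      (yes (i , Ai#0)) → M≰N (s≤s (pivot i (#⇒invertible Ai#0)))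
    where
    pivot : ∀ i → (∃[ d ] d * (A zero i - 0#) ≈ 1# × (A zero i - 0#) * d ≈ 1#) → M ≤ N
    pivot i (d , dA≈1 , _) = injective⇒≤ (λ s → eliminate i r (A (suc s))) λ u Eu≈0 k →
      trans (reflexive (≡.sym (insertAt-punchIn u i _ k)))
            (inj (solveFor i r u) (solved u Eu≈0) (punchIn i k))
      where
      r : Vector Carrier (suc M)
      r k = d * A zero k

      ri≈1 : r i ≈ 1#
      ri≈1 = trans (*-congˡ (sym (x-0≈x _))) dA≈1

      row-zero : ∀ k → eliminate i r (A zero) k ≈ 0#
      row-zero k = trans (+-congˡ (-‿cong (begin
        A zero i * (d * A zero (punchIn i k)) ≈⟨ *-assoc _ _ _ ⟨
        A zero i * d * A zero (punchIn i k)   ≈⟨ *-congʳ (trans (*-comm _ _) ri≈1) ⟩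
        1# * A zero (punchIn i k)             ≈⟨ *-identityˡ _ ⟩
        A zero (punchIn i k)                  ∎))) (-‿inverseʳ _)

      solved : ∀ u → (∀ s → dot (eliminate i r (A (suc s))) u ≈ 0#) →
               ∀ s → dot (A s) (solveFor i r u) ≈ 0#
      solved u Eu≈0 zero    = trans (dot-solveFor i r (A zero) u)
        (sum-zero λ k → trans (*-congʳ (row-zero k)) (zeroˡ _))
      solved u Eu≈0 (suc s) = trans (dot-solveFor i r (A (suc s)) u) (Eu≈0 s)

  -- Linear functionals on polynomials, given by their values on monomials.

  pair : ∀ {n} → (Vec ℕ n → Carrier) → Poly F n → Carrier
  pair W []            = 0#
  pair W ((a , e) ∷ p) = a * W e + pair W p

  module _ {n : ℕ} where

    private
      _≟_ = Vecₚ.≡-dec {n = n} ℕₚ._≟_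

    sumOver : List (Vec ℕ n) → (Vec ℕ n → Carrier) → Carrier
    sumOver []       f = 0#
    sumOver (m ∷ ms) f = f m + sumOver ms f

    sumOver-cong : ∀ ms {f g} → (∀ m → f m ≈ g m) → sumOver ms f ≈ sumOver ms g
    sumOver-cong []       f≈g = refl
    sumOver-cong (m ∷ ms) f≈g = +-cong (f≈g m) (sumOver-cong ms f≈g)

    sumOver-+ : ∀ ms f g → sumOver ms (λ m → f m + g m) ≈ sumOver ms f + sumOver ms g
    sumOver-+ []       f g = sym (+-identityˡ 0#)
    sumOver-+ (m ∷ ms) f g = trans (+-congˡ (sumOver-+ ms f g)) (interchange _ _ _ _)

    term : Carrier → Vec ℕ n → Vec ℕ n → Carrier
    term a e m = if does (e ≟ m) then a else 0#

    term-≡ : ∀ a e → term a e e ≈ a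
    term-≡ a e with does (e ≟ e) | dec-true (e ≟ e) ≡.refl
    ... | true | _ = refl

    term-≢ : ∀ a {e m} → e ≡.≢ m → term a e m ≈ 0#
    term-≢ a {e} {m} e≢m with does (e ≟ m) | dec-false (e ≟ m) e≢m
    ... | false | _ = refl

    sumOver-∉ : ∀ (W : Vec ℕ n → Carrier) a e {ms} → e ∉ ms →
                sumOver ms (λ m → term a e m * W m) ≈ 0#
    sumOver-∉ W a e {[]}     e∉ms = refl
    sumOver-∉ W a e {m ∷ ms} e∉ms = trans
      (+-cong (trans (*-congʳ (term-≢ a (e∉ms ∘ here))) (zeroˡ (W m)))
              (sumOver-∉ W a e (e∉ms ∘ there)))
      (+-identityˡ 0#)

    sumOver-∈ : ∀ (W : Vec ℕ n → Carrier) a e {ms} → Unique ms → e ∈ ms →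
                sumOver ms (λ m → term a e m * W m) ≈ a * W e
    sumOver-∈ W a e (e≢ms ∷ _) (here ≡.refl) = trans
      (+-cong (*-congʳ (term-≡ a e)) (sumOver-∉ W a e (Allₚ.All¬⇒¬Any e≢ms)))
      (+-identityʳ _)
    sumOver-∈ W a e {m ∷ ms} (m≢ms ∷ !ms) (there e∈ms) = trans
      (+-cong (trans (*-congʳ (term-≢ a {e} {m} λ { ≡.refl → Allₚ.All¬⇒¬Any m≢ms e∈ms })) (zeroˡ (W m)))
              (sumOver-∈ W a e !ms e∈ms))
      (+-identityˡ _)

    -- Each term of `p` meets exactly one entry of the duplicate-free list `ms`. The right-hand side
    -- sees `p` only through its coefficients.
    pair≈sumOver : ∀ W {ms} → Unique ms → (p : Poly F n) →
                   (∀ {e} → e ∈ List.map proj₂ p → e ∈ ms) →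
                   pair W p ≈ sumOver ms (λ m → coeff F p m * W m)
    pair≈sumOver W {ms} !ms []            p⊆ms = sym (zeros ms)
      where
      zeros : ∀ ms → sumOver ms (λ m → 0# * W m) ≈ 0#
      zeros []       = refl
      zeros (m ∷ ms) = trans (+-cong (zeroˡ _) (zeros ms)) (+-identityˡ 0#)
    pair≈sumOver W {ms} !ms ((a , e) ∷ p) p⊆ms = begin
      a * W e + pair W p
        ≈⟨ +-cong (sym (sumOver-∈ W a e !ms (p⊆ms (here ≡.refl))))
                  (pair≈sumOver W !ms p (p⊆ms ∘ there)) ⟩
      sumOver ms (λ m → term a e m * W m) + sumOver ms (λ m → coeff F p m * W m)
        ≈⟨ sumOver-+ ms _ _ ⟨
      sumOver ms (λ m → term a e m * W m + coeff F p m * W m)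
        ≈⟨ sumOver-cong ms (λ m → distribʳ (W m) _ _) ⟨
      sumOver ms (λ m → coeff F ((a , e) ∷ p) m * W m) ∎

    -- Both pairings become sums over one duplicate-free list holding the exponents of `p` and of
    -- `q`. This carries what is known about a circuit's output over to the polynomial it computes.
    pair-≋ : ∀ W {p q : Poly F n} → _≋_ F p q → pair W p ≈ pair W q
    pair-≋ W {p} {q} p≋q = begin
      pair W p                             ≈⟨ pair≈sumOver W !ms p (∈-deduplicate⁺ _≟_ ∘ ∈-++⁺ˡ) ⟩
      sumOver ms (λ m → coeff F p m * W m) ≈⟨ sumOver-cong ms (λ m → *-congʳ (p≋q m)) ⟩
      sumOver ms (λ m → coeff F q m * W m) ≈⟨ pair≈sumOver W !ms q (∈-deduplicate⁺ _≟_ ∘ ∈-++⁺ʳ _) ⟨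
      pair W q                             ∎
      where
      ms  = List.deduplicate _≟_ (List.map proj₂ p ++ List.map proj₂ q)
      !ms = UniqueDec.deduplicate-! _≟_ (List.map proj₂ p ++ List.map proj₂ q)

    pair-cong : ∀ {W W′} → (∀ e → W e ≈ W′ e) → (p : Poly F n) → pair W p ≈ pair W′ p
    pair-cong W≈W′ []            = refl
    pair-cong W≈W′ ((a , e) ∷ p) = +-cong (*-congˡ (W≈W′ e)) (pair-cong W≈W′ p)

    pair-zero : ∀ (p : Poly F n) → pair (λ _ → 0#) p ≈ 0#
    pair-zero []            = refl
    pair-zero ((a , e) ∷ p) = trans (+-cong (zeroʳ a) (pair-zero p)) (+-identityˡ 0#)

    pair-sum : ∀ {s} (α : Vector Carrier s) (W : Fin s → Vec ℕ n → Carrier) (p : Poly F n) →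
               pair (λ e → sum λ i → α i * W i e) p ≈ sum λ i → α i * pair (W i) p
    pair-sum {s} α W []            = sym (sum-zero {s} λ i → zeroʳ (α i))
    pair-sum {s} α W ((a , e) ∷ p) = begin
      a * sum (λ i → α i * W i e) + pair (λ e → sum λ i → α i * W i e) p
        ≈⟨ +-cong (*-distribˡ-sum a (λ i → α i * W i e)) (pair-sum α W p) ⟩
      sum (λ i → a * (α i * W i e)) + sum (λ i → α i * pair (W i) p)
        ≈⟨ ∑-distrib-+ {s} _ _ ⟨
      sum (λ i → a * (α i * W i e) + α i * pair (W i) p)
        ≈⟨ sum-cong-≋ {s} (λ i → trans (+-congʳ (x∙yz≈y∙xz a (α i) _)) (sym (distribˡ (α i) _ _))) ⟩
      sum (λ i → α i * (a * W i e + pair (W i) p)) ∎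

    pair-⊕ : ∀ W (p q : Poly F n) → pair W (_⊕_ F p q) ≈ pair W p + pair W q
    pair-⊕ W []            q = sym (+-identityˡ _)
    pair-⊕ W ((a , e) ∷ p) q = trans (+-congˡ (pair-⊕ W p q)) (sym (+-assoc _ _ _))

    -- The map is a variable `g` because `_⊗_` uses an anonymous pattern-matching function, which
    -- can only be described by its values on pairs.
    pair-shift : ∀ W a e (g : Carrier × Vec ℕ n → Carrier × Vec ℕ n) →
                 (∀ b f → g (b , f) ≡ (a * b , e +ᵉ f)) → (q : Poly F n) →
                 pair W (List.map g q) ≈ a * pair (λ f → W (e +ᵉ f)) q
    pair-shift W a e g g≗ []            = sym (zeroʳ a)
    pair-shift W a e g g≗ ((b , f) ∷ q) rewrite g≗ b f = begin
      a * b * W (e +ᵉ f) + pair W (List.map g q)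
        ≈⟨ +-cong (*-assoc _ _ _) (pair-shift W a e g g≗ q) ⟩
      a * (b * W (e +ᵉ f)) + a * pair (λ f → W (e +ᵉ f)) q
        ≈⟨ distribˡ a _ _ ⟨
      a * (b * W (e +ᵉ f) + pair (λ f → W (e +ᵉ f)) q) ∎

    pair-⊗ : ∀ W (p q : Poly F n) →
             pair W (_⊗_ F p q) ≈ pair (λ e → pair (λ f → W (e +ᵉ f)) q) p
    pair-⊗ W []            q = refl
    pair-⊗ W ((a , e) ∷ p) q = trans (pair-⊕ W (List.map _ q) (_⊗_ F p q))
      (+-cong (pair-shift W a e _ (λ _ _ → ≡.refl) q) (pair-⊗ W p q))

    pair-affine : ∀ W (a : AffineForm F n) → pair W (affinePoly F a) ≈
                  a zero * W 𝟎 + sum λ t → a (suc t) * W (unitExponent F t)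
    pair-affine W a = +-congˡ (linear-part id)
      where
      linear-part : ∀ {s} (h : Fin s → Fin n) →
        pair W (List.map (λ i → a (suc i) , unitExponent F i) (List.tabulate h)) ≈
        sum λ t → a (suc (h t)) * W (unitExponent F (h t))
      linear-part {zero}  h = refl
      linear-part {suc s} h = +-congˡ (linear-part (h ∘ suc))

    pair-affine-⊗ : ∀ W (a : AffineForm F n) (q : Poly F n) →
      pair W (_⊗_ F (affinePoly F a) q) ≈
      a zero * pair W q + sum λ t → a (suc t) * pair (λ f → W (unitExponent F t +ᵉ f)) q
    pair-affine-⊗ W a q = begin
      pair W (_⊗_ F (affinePoly F a) q)                          ≈⟨ pair-⊗ W (affinePoly F a) q ⟩
      pair (λ e → pair (λ f → W (e +ᵉ f)) q) (affinePoly F a)    ≈⟨ pair-affine _ a ⟩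
      a zero * pair (λ f → W (𝟎 +ᵉ f)) q + _
        ≈⟨ +-congʳ (*-congˡ (pair-cong (λ f → reflexive (≡.cong W (𝟎-identityˡ f))) q)) ⟩
      a zero * pair W q + _                                      ∎

  -- Finite sums: selecting one term, and splitting into blocks.

  sum-single : ∀ {N} (f : Vector Carrier N) i → (∀ j → j ≡.≢ i → f j ≈ 0#) → sum f ≈ f i
  sum-single {suc N} f i others = begin
    sum f                       ≈⟨ sum-remove {i = i} f ⟩
    f i + sum (f ∘ punchIn i)
      ≈⟨ +-congˡ (sum-zero {N} λ j → others (punchIn i j) (Finₚ.punchInᵢ≢i i j)) ⟩
    f i + 0#                    ≈⟨ +-identityʳ (f i) ⟩
    f i                         ∎

  sum-split : ∀ K {N} (f : ℕ → Carrier) →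
    sum {K ℕ.+ N} (f ∘ toℕ) ≈ sum {K} (f ∘ toℕ) + sum {N} (λ i → f (K ℕ.+ toℕ i))
  sum-split zero    f = sym (+-identityˡ _)
  sum-split (suc K) f = trans (+-congˡ (sum-split K (f ∘ suc))) (sym (+-assoc _ _ _))

  -- With `s = 5` and `K = 5 ^ m` this splits off the leading base-5 digit of the index.
  sum-blocks : ∀ s K (f : ℕ → Carrier) →
    sum {s} (λ j → sum {K} λ i → f (toℕ j ℕ.* K ℕ.+ toℕ i)) ≈ sum {s ℕ.* K} (f ∘ toℕ)
  sum-blocks zero    K f = refl
  sum-blocks (suc s) K f = begin
    sum {K} (f ∘ toℕ) + sum {s} (λ j → sum {K} λ i → f (K ℕ.+ toℕ j ℕ.* K ℕ.+ toℕ i))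
      ≈⟨ +-congˡ (sum-cong-≋ {s} λ j → sum-cong-≋ {K} λ i →
           reflexive (≡.cong f (ℕₚ.+-assoc K (toℕ j ℕ.* K) (toℕ i)))) ⟩
    sum {K} (f ∘ toℕ) + sum {s} (λ j → sum {K} λ i → f (K ℕ.+ (toℕ j ℕ.* K ℕ.+ toℕ i)))
      ≈⟨ +-congˡ (sum-blocks s K (f ∘ (K ℕ.+_))) ⟩
    sum {K} (f ∘ toℕ) + sum {s ℕ.* K} (λ i → f (K ℕ.+ toℕ i))
      ≈⟨ sum-split K f ⟨
    sum {suc s ℕ.* K} (f ∘ toℕ) ∎

  -- A unit vector for `x < N` and the zero vector beyond, so that `dot (δ x) u` continues `u` by
  -- zeros.
  δ : ∀ {N} → ℕ → Vector Carrier N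
  δ x i = if does (x ℕₚ.≟ toℕ i) then 1# else 0#

  δ-≡ : ∀ {N} (i : Fin N) → δ (toℕ i) i ≈ 1#
  δ-≡ i with does (toℕ i ℕₚ.≟ toℕ i) | dec-true (toℕ i ℕₚ.≟ toℕ i) ≡.refl
  ... | true | _ = refl

  δ-≢ : ∀ {N x} (i : Fin N) → x ≡.≢ toℕ i → δ x i ≈ 0#
  δ-≢ {x = x} i x≢i with does (x ℕₚ.≟ toℕ i) | dec-false (x ℕₚ.≟ toℕ i) x≢i
  ... | false | _ = refl

  -- Functionals on F[q] that vanish on all monomials of a given degree in given polynomials.

  module Sequences {n : ℕ} (w : Fin n → ℕ) where

    -- The action of the univariate polynomial Σ αₜ q^(w t) on functionals u of F[q],
    -- where u c stands for u(q^c).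
    act : Vector Carrier n → (ℕ → Carrier) → ℕ → Carrier
    act α u c = sum λ t → α t * u (w t ℕ.+ c)

    act-cong : ∀ α {u v} → (∀ c → u c ≈ v c) → ∀ c → act α u c ≈ act α v c
    act-cong α u≈v c = sum-cong-≋ {n} λ t → *-congˡ (u≈v _)

    act-linearʳ : ∀ {s} α (κ : Vector Carrier s) (U : Fin s → ℕ → Carrier) x →
                  act α (λ y → sum λ i → κ i * U i y) x ≈ sum λ i → κ i * act α (U i) x
    act-linearʳ {s} α κ U x = begin
      sum (λ t → α t * sum (λ i → κ i * U i (w t ℕ.+ x)))
        ≈⟨ sum-cong-≋ {n} (λ t → *-distribˡ-sum (α t) (λ i → κ i * U i (w t ℕ.+ x))) ⟩
      sum (λ t → sum (λ i → α t * (κ i * U i (w t ℕ.+ x))))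
        ≈⟨ ∑-comm {n} {s} _ ⟩
      sum (λ i → sum (λ t → α t * (κ i * U i (w t ℕ.+ x))))
        ≈⟨ sum-cong-≋ {s} (λ i → sum-cong-≋ {n} λ t → x∙yz≈y∙xz (α t) (κ i) _) ⟩
      sum (λ i → sum (λ t → κ i * (α t * U i (w t ℕ.+ x))))
        ≈⟨ sum-cong-≋ {s} (λ i → *-distribˡ-sum (κ i) (λ t → α t * U i (w t ℕ.+ x))) ⟨
      sum (λ i → κ i * act α (U i) x) ∎

    act-linearˡ : ∀ {s} (κ : Vector Carrier s) (β : Fin s → Vector Carrier n) u x →
                  act (λ t → sum λ i → κ i * β i t) u x ≈ sum λ i → κ i * act (β i) u x
    act-linearˡ {s} κ β u x = begin
      sum (λ t → sum (λ i → κ i * β i t) * u (w t ℕ.+ x))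
        ≈⟨ sum-cong-≋ {n} (λ t → *-distribʳ-sum (u (w t ℕ.+ x)) (λ i → κ i * β i t)) ⟩
      sum (λ t → sum (λ i → κ i * β i t * u (w t ℕ.+ x)))
        ≈⟨ ∑-comm {n} {s} _ ⟩
      sum (λ i → sum (λ t → κ i * β i t * u (w t ℕ.+ x)))
        ≈⟨ sum-cong-≋ {s} (λ i → sum-cong-≋ {n} λ t → *-assoc (κ i) (β i t) _) ⟩
      sum (λ i → sum (λ t → κ i * (β i t * u (w t ℕ.+ x))))
        ≈⟨ sum-cong-≋ {s} (λ i → *-distribˡ-sum (κ i) (λ t → β i t * u (w t ℕ.+ x))) ⟨
      sum (λ i → κ i * act (β i) u x) ∎

    -- Commutativity of F[q], carried over to its action on functionals.
    act-comm : ∀ α β u x → act α (act β u) x ≈ act β (act α u) x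
    act-comm α β u x = begin
      act α (act β u) x
        ≈⟨ act-linearʳ α β (λ s y → u (w s ℕ.+ y)) x ⟩
      sum (λ s → β s * sum (λ t → α t * u (w s ℕ.+ (w t ℕ.+ x))))
        ≈⟨ sum-cong-≋ {n} (λ s → *-congˡ (sum-cong-≋ {n} λ t →
             *-congˡ (reflexive (≡.cong u (x∙yz≡y∙xz (w s) (w t) x))))) ⟩
      act β (act α u) x ∎
      where
      open CommutativeSemigroupProperties ℕₚ.+-commutativeSemigroup
        renaming (x∙yz≈y∙xz to x∙yz≡y∙xz)

    -- The functional u vanishes on every degree k monomial in the polynomials b.  Only
    -- sorted monomials are listed, so that there are at most 2^(d+k) conditions.
    Annihilates : ∀ {d} → ℕ → (Fin d → Vector Carrier n) → (ℕ → Carrier) → Set ℓ₁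
    Annihilates         zero    b u = u 0 ≈ 0#
    Annihilates {zero}  (suc k) b u = ⊤
    Annihilates {suc d} (suc k) b u =
      Annihilates (suc k) (b ∘ suc) u × Annihilates k b (act (b zero) u)

    Annihilates-cong : ∀ {d} k (b : Fin d → Vector Carrier n) {u v} → (∀ x → u x ≈ v x) →
                       Annihilates k b u → Annihilates k b v
    Annihilates-cong         zero    b u≈v A         = trans (sym (u≈v 0)) A
    Annihilates-cong {zero}  (suc k) b u≈v A         = tt
    Annihilates-cong {suc d} (suc k) b u≈v (A₁ , A₂) =
      Annihilates-cong (suc k) (b ∘ suc) u≈v A₁ ,
      Annihilates-cong k b (act-cong (b zero) u≈v) A₂

    Annihilates-linear : ∀ {d s} k (b : Fin d → Vector Carrier n)
      (κ : Vector Carrier s) (U : Fin s → ℕ → Carrier) →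
      (∀ i → Annihilates k b (U i)) → Annihilates k b (λ x → sum λ i → κ i * U i x)
    Annihilates-linear {d} {s} zero b κ U A =
      sum-zero {s} λ i → trans (*-congˡ (A i)) (zeroʳ (κ i))
    Annihilates-linear {zero}  (suc k) b κ U A = tt
    Annihilates-linear {suc d} (suc k) b κ U A =
      Annihilates-linear (suc k) (b ∘ suc) κ U (proj₁ ∘ A) ,
      Annihilates-cong k b (λ x → sym (act-linearʳ (b zero) κ U x))
        (Annihilates-linear k b κ (λ i → act (b zero) (U i)) (proj₂ ∘ A))

    -- The definition multiplies by the polynomials in sorted order only; `act-comm` moves `b i`
    -- past the earlier ones.
    Annihilates-act : ∀ {d} k (b : Fin d → Vector Carrier n) {u} → Annihilates (suc k) b u →
                      ∀ i → Annihilates k b (act (b i) u)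
    Annihilates-act k       b (A₁ , A₂) zero    = A₂
    Annihilates-act zero    b (A₁ , A₂) (suc i) = Annihilates-act zero (b ∘ suc) A₁ i
    Annihilates-act (suc k) b {u} (A₁ , A₂) (suc i) =
      Annihilates-act (suc k) (b ∘ suc) A₁ i ,
      Annihilates-cong k b (act-comm (b (suc i)) (b zero) u) (Annihilates-act k b A₂ (suc i))

    Annihilates-span : ∀ {d} k (b : Fin d → Vector Carrier n) {u} → Annihilates (suc k) b u →
      ∀ (κ : Vector Carrier d) {α} → (∀ t → α t ≈ sum λ i → κ i * b i t) →
      Annihilates k b (act α u)
    Annihilates-span k b {u} A κ {α} α≈ = Annihilates-cong k b
      (λ x → sym (trans (sum-cong-≋ {n} λ t → *-congʳ (α≈ t)) (act-linearˡ κ b u x)))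
      (Annihilates-linear k b κ (λ i → act (b i) u) (Annihilates-act k b A))

    -- W x is a linear form in M unknowns u; the sequence at W u depends linearly on u.
    at : ∀ {M} → (ℕ → Vector Carrier M) → Vector Carrier M → ℕ → Carrier
    at W u x = dot (W x) u

    act-at : ∀ {M} α (W : ℕ → Vector Carrier M) u x →
             at (λ y i → act α (λ z → W z i) y) u x ≈ act α (at W u) x
    act-at {M} α W u x = begin
      sum (λ i → act α (λ z → W z i) x * u i)
        ≈⟨ sum-cong-≋ {M} (λ i → *-comm _ (u i)) ⟩
      sum (λ i → u i * act α (λ z → W z i) x)
        ≈⟨ act-linearʳ α u (λ i z → W z i) x ⟨
      act α (λ y → sum (λ i → u i * W y i)) x
        ≈⟨ act-cong α (λ y → sum-cong-≋ {M} λ i → *-comm (u i) (W y i)) x ⟩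
      act α (at W u) x ∎

    -- Only the implication from the equations to `P` is recorded: `P` holds on some subspace cut
    -- out by at most `X` equations.
    record Codimension≤ (M X : ℕ) {p} (P : Vector Carrier M → Set p) : Set (c ⊔ ℓ₁ ⊔ p) where
      field
        {equations} : ℕ
        equations≤  : equations ≤ X
        matrix      : Fin equations → Vector Carrier M
        solutions   : ∀ u → (∀ r → dot (matrix r) u ≈ 0#) → P u

    open Codimension≤

    Codimension≤-× : ∀ {M X Y p q} {P : Vector Carrier M → Set p} {Q : Vector Carrier M → Set q} →
                     Codimension≤ M X P → Codimension≤ M Y Q →
                     Codimension≤ M (X ℕ.+ Y) (λ u → P u × Q u)
    Codimension≤-× A B = record
      { equations≤ = ℕₚ.+-mono-≤ (A .equations≤) (B .equations≤)
      ; matrix     = A .matrix Vector.++ B .matrix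
      ; solutions  = λ u ABu≈0 →
          A .solutions u (λ r → trans
            (reflexive (≡.cong (λ s → dot s u) (≡.sym (lookup-++ˡ (A .matrix) (B .matrix) r))))
            (ABu≈0 (r ↑ˡ _))) ,
          B .solutions u (λ r → trans
            (reflexive (≡.cong (λ s → dot s u) (≡.sym (lookup-++ʳ (A .matrix) (B .matrix) r))))
            (ABu≈0 (_ ↑ʳ r)))
      }

    Codimension≤-weaken : ∀ {M X Y p q}
                            {P : Vector Carrier M → Set p} {Q : Vector Carrier M → Set q} →
                          X ≤ Y → (∀ u → P u → Q u) → Codimension≤ M X P → Codimension≤ M Y Q
    Codimension≤-weaken X≤Y P⇒Q A = record
      { equations≤ = ℕₚ.≤-trans (A .equations≤) X≤Y
      ; matrix     = A .matrix
      ; solutions  = λ u Au≈0 → P⇒Q u (A .solutions u Au≈0)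
      }

    Codimension≤-∀ : ∀ {M X k p} {P : Fin k → Vector Carrier M → Set p} →
                     (∀ j → Codimension≤ M X (P j)) → Codimension≤ M (k ℕ.* X) (λ u → ∀ j → P j u)
    Codimension≤-∀ {k = zero} A = record
      { equations≤ = z≤n ; matrix = λ () ; solutions = λ _ _ () }
    Codimension≤-∀ {k = suc k} A = Codimension≤-weaken ℕₚ.≤-refl
      (λ u (P₀ , Pₛ) → λ where
        zero    → P₀
        (suc j) → Pₛ j)
      (Codimension≤-× (A zero) (Codimension≤-∀ (A ∘ suc)))

    -- The count obeys Pascal's recursion: a sorted monomial either avoids `b zero` or is `b zero`
    -- times one of lower degree, and each case costs at most half of the bound. `W` is arbitrary
    -- because the second case replaces it by its image under `b zero`.
    Annihilates-codimension≤ : ∀ {M d} k (b : Fin d → Vector Carrier n) (W : ℕ → Vector Carrier M) →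
      Codimension≤ M (2 ℕ.^ (d ℕ.+ k)) (λ u → Annihilates k b (at W u))
    Annihilates-codimension≤ {d = d} zero b W = record
      { equations≤ = ℕₚ.m^n>0 2 (d ℕ.+ 0)
      ; matrix     = λ (_ : Fin 1) → W 0
      ; solutions  = λ u Wu≈0 → Wu≈0 zero
      }
    Annihilates-codimension≤ {d = zero} (suc k) b W = record
      { equations≤ = z≤n ; matrix = λ () ; solutions = λ _ _ → tt }
    Annihilates-codimension≤ {d = suc d} (suc k) b W = Codimension≤-weaken
      (ℕₚ.+-monoʳ-≤ (2 ℕ.^ (d ℕ.+ suc k)) (ℕₚ.≤-reflexive
        (≡.trans (≡.cong (2 ℕ.^_) (≡.sym (ℕₚ.+-suc d k))) (≡.sym (ℕₚ.+-identityʳ _)))))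
      (λ u (A₁ , A₂) → A₁ , Annihilates-cong k b (act-at (b zero) W u) A₂)
      (Codimension≤-× (Annihilates-codimension≤ (suc k) (b ∘ suc) W)
                      (Annihilates-codimension≤ k b (λ y i → act (b zero) (λ z → W z i) y)))

  -- The Kronecker substitution and its effect on products of affine forms.

  module Kronecker {n : ℕ} (isY : Fin n → Bool) (w : Fin n → ℕ) where

    open Sequences w

    yDegree yIndex zIndex : Vec ℕ n → ℕ
    yDegree = weigh λ t → if isY t then 1 else 0
    yIndex  = weigh λ t → if isY t then w t else 0
    zIndex  = weigh λ t → if isY t then 0 else w t

    -- Under the Kronecker substitution y_t ↦ s q^(w t), z_t ↦ r^(w t), this is the
    -- functional sending s^k q^a r^b to u a * v b and s^k′ q^a r^b to 0 for k′ ≢ k.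
    kron : ℕ → (ℕ → Carrier) → (ℕ → Carrier) → Vec ℕ n → Carrier
    kron k u v e = if yDegree e ≡ᵇ k then u (yIndex e) * v (zIndex e) else 0#

    kron-y-zero : ∀ {t} u v → isY t ≡ true → ∀ e → kron zero u v (unitExponent F t +ᵉ e) ≡ 0#
    kron-y-zero {t} u v t∈Y e
      rewrite weigh-shift (λ t → if isY t then 1 else 0) t e | t∈Y = ≡.refl

    kron-y : ∀ {t} k u v → isY t ≡ true → ∀ e →
             kron (suc k) u v (unitExponent F t +ᵉ e) ≡ kron k (λ x → u (w t ℕ.+ x)) v e
    kron-y {t} k u v t∈Y e
      rewrite weigh-shift (λ t → if isY t then 1 else 0) t e
            | weigh-shift (λ t → if isY t then w t else 0) t e
            | weigh-shift (λ t → if isY t then 0 else w t) t e | t∈Y = ≡.refl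

    kron-z : ∀ {t} k u v → isY t ≡ false → ∀ e →
             kron k u v (unitExponent F t +ᵉ e) ≡ kron k u (λ x → v (w t ℕ.+ x)) e
    kron-z {t} k u v t∉Y e
      rewrite weigh-shift (λ t → if isY t then 1 else 0) t e
            | weigh-shift (λ t → if isY t then w t else 0) t e
            | weigh-shift (λ t → if isY t then 0 else w t) t e | t∉Y = ≡.refl

    kron-linear : ∀ {s} k (κ : Vector Carrier s) (U : Fin s → ℕ → Carrier) v e →
                  kron k (λ x → sum λ i → κ i * U i x) v e ≈ sum λ i → κ i * kron k (U i) v e
    kron-linear {s} k κ U v e with yDegree e ≡ᵇ k
    ... | true  = trans (*-distribʳ-sum (v (zIndex e)) (λ i → κ i * U i (yIndex e)))
                        (sum-cong-≋ {s} λ i → *-assoc (κ i) (U i (yIndex e)) (v (zIndex e)))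
    ... | false = sym (sum-zero {s} λ i → zeroʳ (κ i))

    kron-𝟎 : ∀ u v → kron zero u v 𝟎 ≡ u 0 * v 0
    kron-𝟎 u v
      rewrite weigh-𝟎 (λ t → if isY t then 1 else 0)
            | weigh-𝟎 (λ t → if isY t then w t else 0)
            | weigh-𝟎 (λ t → if isY t then 0 else w t) = ≡.refl

    kron-𝟎-suc : ∀ k u v → kron (suc k) u v 𝟎 ≡ 0#
    kron-𝟎-suc k u v rewrite weigh-𝟎 (λ t → if isY t then 1 else 0) = ≡.refl

    pair-const : ∀ (W : Vec ℕ n → Carrier) a → pair W (const F a) ≈ a * W 𝟎
    pair-const W a = +-identityʳ _

    -- Represents the coefficient λ of s in the substituted form λ s + μ; the constant term and the
    -- z-variables belong to μ.
    yPart : AffineForm F n → Vector Carrier n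
    yPart a t = if isY t then a (suc t) else 0#

    yPart-span : ∀ {d} (b : Fin d → AffineForm F n) {a} → _∈Span_ F a b →
                 ∃[ κ ] (∀ t → yPart a t ≈ sum λ i → κ i * yPart (b i) t)
    yPart-span {d} b {a} (κ , a≈) = κ , λ t → by-cases t (isY t)
      where
      by-cases : ∀ t y → (if y then a (suc t) else 0#) ≈
                         sum λ i → κ i * (if y then b i (suc t) else 0#)
      by-cases t true  = a≈ (suc t)
      by-cases t false = sym (sum-zero {d} λ i → zeroʳ (κ i))

    -- Induction on the factors. In the first factor λ s + μ, the part μ keeps `k` and `u` and at
    -- most shifts `v`, which is why `v` is arbitrary. The part λ s lowers `k` by one and replaces
    -- `u` by its image under λ, to which `Annihilates-span` applies. For `k = 0` the terms with s
    -- contribute nothing.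
    pair-kron-product : ∀ {d s} (b : Fin d → AffineForm F n) (L : Fin s → AffineForm F n) →
      (∀ i → _∈Span_ F (L i) b) →
      ∀ k u v → Annihilates k (yPart ∘ b) u →
      pair (kron k u v) (foldr (_⊗_ F) (const F 1#) (affinePoly F ∘ L)) ≈ 0#
    pair-kron-product {s = zero} b L L∈b zero u v A = begin
      pair (kron zero u v) (const F 1#) ≈⟨ pair-const (kron zero u v) 1# ⟩
      1# * kron zero u v 𝟎              ≈⟨ *-congˡ (reflexive (kron-𝟎 u v)) ⟩
      1# * (u 0 * v 0)                  ≈⟨ *-congˡ (trans (*-congʳ A) (zeroˡ (v 0))) ⟩
      1# * 0#                           ≈⟨ zeroʳ 1# ⟩
      0#                                ∎
    pair-kron-product {s = zero} b L L∈b (suc k) u v A =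
      trans (pair-const (kron (suc k) u v) 1#)
            (trans (*-congˡ (reflexive (kron-𝟎-suc k u v))) (zeroʳ 1#))
    pair-kron-product {s = suc s} b L L∈b k u v A = begin
      pair (kron k u v) (_⊗_ F (affinePoly F a) q)  ≈⟨ pair-affine-⊗ (kron k u v) a q ⟩
      a zero * pair (kron k u v) q + sum (λ t → a (suc t) * pair (shifted k u t) q)
        ≈⟨ +-cong (trans (*-congˡ (IH k u v A)) (zeroʳ _)) (linear-part k u A) ⟩
      0# + 0#                                       ≈⟨ +-identityˡ 0# ⟩
      0#                                            ∎
      where
      a = L zero
      q = foldr (_⊗_ F) (const F 1#) (affinePoly F ∘ L ∘ suc)
      IH = pair-kron-product b (L ∘ suc) (L∈b ∘ suc)

      shifted : ℕ → (ℕ → Carrier) → Fin n → Vec ℕ n → Carrier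
      shifted k u t f = kron k u v (unitExponent F t +ᵉ f)

      z-term : ∀ k u → Annihilates k (yPart ∘ b) u → ∀ t → isY t ≡ false →
               pair (shifted k u t) q ≈ 0#
      z-term k u A t t∉Y = trans (pair-cong (λ f → reflexive (kron-z k u v t∉Y f)) q)
                                 (IH k u (λ x → v (w t ℕ.+ x)) A)

      linear-part : ∀ k u → Annihilates k (yPart ∘ b) u →
                    sum (λ t → a (suc t) * pair (shifted k u t) q) ≈ 0#
      linear-part zero u A = sum-zero {n} λ t →
        trans (*-congˡ (vanishes t _ ≡.refl)) (zeroʳ (a (suc t)))
        where
        vanishes : ∀ t y → isY t ≡ y → pair (shifted zero u t) q ≈ 0#
        vanishes t true  t∈Y = trans (pair-cong (λ f → reflexive (kron-y-zero u v t∈Y f)) q)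
                                     (pair-zero q)
        vanishes t false t∉Y = z-term zero u A t t∉Y
      -- The z-terms vanish by induction. The y-terms all have the same `k` and `v`, so by linearity
      -- they merge into one functional, with `u` acted on by λ.
      linear-part (suc k) u A = begin
        sum (λ t → a (suc t) * pair (shifted (suc k) u t) q)
          ≈⟨ sum-cong-≋ {n} (λ t → by-cases t (isY t) ≡.refl) ⟩
        sum (λ t → yPart a t * pair (kron k (λ x → u (w t ℕ.+ x)) v) q)
          ≈⟨ pair-sum (yPart a) (λ t → kron k (λ x → u (w t ℕ.+ x)) v) q ⟨
        pair (λ e → sum λ t → yPart a t * kron k (λ x → u (w t ℕ.+ x)) v e) q
          ≈⟨ pair-cong (kron-linear k (yPart a) (λ t x → u (w t ℕ.+ x)) v) q ⟨
        pair (kron k (act (yPart a) u) v) q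
          ≈⟨ IH k (act (yPart a) u) v (Annihilates-span k (yPart ∘ b) A (proj₁ span) (proj₂ span)) ⟩
        0# ∎
        where
        span = yPart-span b (L∈b zero)
        by-cases : ∀ t y → isY t ≡ y →
          a (suc t) * pair (shifted (suc k) u t) q ≈
          (if y then a (suc t) else 0#) * pair (kron k (λ x → u (w t ℕ.+ x)) v) q
        by-cases t true  t∈Y = *-congˡ (pair-cong (λ f → reflexive (kron-y k u v t∈Y f)) q)
        by-cases t false t∉Y =
          trans (trans (*-congˡ (z-term (suc k) u A t t∉Y)) (zeroʳ _)) (sym (zeroˡ _))

    kron-yz : ∀ {y z} k u v → isY y ≡ true → isY z ≡ false → ∀ e →
              kron (suc k) u v (unitExponent F y +ᵉ unitExponent F z +ᵉ e) ≡
              kron k (λ x → u (w y ℕ.+ x)) (λ x → v (w z ℕ.+ x)) e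
    kron-yz {y} {z} k u v y∈Y z∉Y e = ≡.trans
      (≡.cong (kron (suc k) u v)
        (Vecₚ.zipWith-assoc ℕₚ.+-assoc (unitExponent F y) (unitExponent F z) e))
      (≡.trans (kron-y k u v y∈Y _) (kron-z k (λ x → u (w y ℕ.+ x)) v z∉Y e))

  -- Degree bounds for the values of the circuit.

  -- Bounds every listed term, even one that cancels; this makes the bound additive under `_⊗_` by
  -- inspection of the lists.
  TermsOfDegree≤ : ∀ {n} → ℕ → Poly F n → Set c
  TermsOfDegree≤ d = All λ t → Vec.sum (proj₂ t) ≤ d

  module _ {n : ℕ} where

    degreeAtMost : ∀ {d} {p : Poly F n} → TermsOfDegree≤ d p → DegreeAtMost F p d
    degreeAtMost []                              m d<m = refl
    degreeAtMost {p = (a , e) ∷ p} (e≤d ∷ p≤d) m d<m with Vecₚ.≡-dec ℕₚ._≟_ e m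
    ... | yes ≡.refl = contradiction e≤d (ℕₚ.<⇒≱ d<m)
    ... | no  _      = trans (+-identityˡ _) (degreeAtMost p≤d m d<m)

    degree-const : ∀ a → TermsOfDegree≤ 0 (const F {n} a)
    degree-const a = ℕₚ.≤-reflexive (sum-𝟎 n) ∷ []

    degree-var : ∀ t → TermsOfDegree≤ 1 (var F {n} t)
    degree-var t = ℕₚ.≤-reflexive (sum-unit t) ∷ []

    degree-⊗ : ∀ {d d′} {p q : Poly F n} → TermsOfDegree≤ d p → TermsOfDegree≤ d′ q →
               TermsOfDegree≤ (d ℕ.+ d′) (_⊗_ F p q)
    degree-⊗ []          q≤d′ = []
    degree-⊗ {p = (a , e) ∷ p} (e≤d ∷ p≤d) q≤d′ = Allₚ.++⁺
      (Allₚ.map⁺ (All.map (λ {(b , f)} f≤d′ →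
        ℕₚ.≤-trans (ℕₚ.≤-reflexive (sum-+ᵉ e f)) (ℕₚ.+-mono-≤ e≤d f≤d′)) q≤d′))
      (degree-⊗ p≤d q≤d′)

    module _ {v} {ρ : Fin v → Poly F n} (ρ≤1 : ∀ x → TermsOfDegree≤ 1 (ρ x)) where

      degree-addProducts : ∀ {g s} (y z : Fin s → Fin v) (C : ConstantFreeCircuit v (suc g)) →
        TermsOfDegree≤ 2 (value F ρ C) → TermsOfDegree≤ 2 (value F ρ (addProducts y z C))
      degree-addProducts {s = zero}  y z C C≤2 = C≤2
      degree-addProducts {s = suc s} y z C C≤2
        rewrite lookup-zero (gateValues F ρ (addProducts (y ∘ suc) (z ∘ suc) C)) =
        Allₚ.++⁺ (degree-⊗ (ρ≤1 (y zero)) (ρ≤1 (z zero)))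
                 (degree-addProducts (y ∘ suc) (z ∘ suc) C C≤2)

      degree-circuit : ∀ {k} (ι : Fin k → Fin v) m m≤k →
                       TermsOfDegree≤ (m ℕ.* 2) (value F ρ (circuit ι m m≤k))
      degree-circuit ι zero    m≤k = degree-const 1#
      degree-circuit ι (suc m) m<k
        rewrite lookup-zero (gateValues F ρ (circuit ι m (*10-weaken m m<k))) =
        degree-⊗ (degree-addProducts (ι ∘ ySlot m m<k) (ι ∘ zSlot m m<k)
                   (circuit ι m (*10-weaken m m<k) ▷ zero)
                   (All.map (λ p → ℕₚ.≤-trans p z≤n) (degree-const 0#)))
                 (degree-circuit ι m (*10-weaken m m<k))

  -- The coefficient matrix of the product of inner products.

  module CircuitPairing {n v} (ρ : Fin v → Poly F n)
    (ι : Fin n → Fin v) (ρι≡var : ∀ t → ρ (ι t) ≡ var F t) where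

    open Kronecker {n} isYVariable base5Weight

    pair-addProducts : ∀ {g s} (W : Vec ℕ n → Carrier) (y z : Fin s → Fin n)
      (C : ConstantFreeCircuit v (suc g)) →
      pair W (value F ρ (addProducts (ι ∘ y) (ι ∘ z) C)) ≈
      sum (λ j → W (unitExponent F (y j) +ᵉ unitExponent F (z j))) + pair W (value F ρ C)
    pair-addProducts {s = zero}  W y z C = sym (+-identityˡ _)
    pair-addProducts {s = suc s} W y z C
      rewrite lookup-zero (gateValues F ρ (addProducts (ι ∘ y ∘ suc) (ι ∘ z ∘ suc) C))
            | ρι≡var (y zero) | ρι≡var (z zero) = trans
      (+-cong (trans (*-congʳ (*-identityˡ 1#)) (*-identityˡ _))
              (pair-addProducts W (y ∘ suc) (z ∘ suc) C))
      (sym (+-assoc _ _ _))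

    -- The coefficient of s^m is Σ q^c r^c. By induction, choosing the product `y j`, `z j` in the
    -- newest block uses up one s and shifts both `u` and `v` by j 5^m, that is, it puts the digit j
    -- in front of the index.
    pair-circuit : ∀ m m≤n (u v : ℕ → Carrier) →
      pair (kron m u v) (value F ρ (circuit ι m m≤n)) ≈
      sum {5 ℕ.^ m} (λ i → u (toℕ i) * v (toℕ i))
    pair-circuit zero    m≤n u v = +-congʳ (trans (*-identityˡ _) (reflexive (kron-𝟎 u v)))
    pair-circuit (suc m) m<n u v
      rewrite lookup-zero (gateValues F ρ (circuit ι m (*10-weaken m m<n))) = begin
      pair (kron (suc m) u v) (_⊗_ F (value F ρ Σyz) V)
        ≈⟨ pair-⊗ (kron (suc m) u v) (value F ρ Σyz) V ⟩
      pair G (value F ρ Σyz)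
        ≈⟨ pair-addProducts G y z (circuit ι m m≤n ▷ zero) ⟩
      sum (λ j → G (unitExponent F (y j) +ᵉ unitExponent F (z j))) + pair G (const F 0#)
        ≈⟨ +-cong (sum-cong-≋ {5} block) (trans (pair-const G 0#) (zeroˡ _)) ⟩
      sum {5} (λ j → sum {K} λ i → f (toℕ j ℕ.* K ℕ.+ toℕ i)) + 0#
        ≈⟨ +-identityʳ _ ⟩
      sum {5} (λ j → sum {K} λ i → f (toℕ j ℕ.* K ℕ.+ toℕ i))
        ≈⟨ sum-blocks 5 K f ⟩
      sum {5 ℕ.* K} (f ∘ toℕ) ∎
      where
      K = 5 ℕ.^ m
      m≤n = *10-weaken m m<n
      y = ySlot m m<n
      z = zSlot m m<n
      Σyz = addProducts (ι ∘ y) (ι ∘ z) (circuit ι m m≤n ▷ zero)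
      V = value F ρ (circuit ι m m≤n)

      f : ℕ → Carrier
      f x = u x * v x

      G : Vec ℕ n → Carrier
      G e = pair (λ e′ → kron (suc m) u v (e +ᵉ e′)) V

      block : ∀ j → G (unitExponent F (y j) +ᵉ unitExponent F (z j)) ≈
                    sum {K} λ i → f (toℕ j ℕ.* K ℕ.+ toℕ i)
      block j = begin
        G (unitExponent F (y j) +ᵉ unitExponent F (z j))
          ≈⟨ pair-cong (λ e → reflexive (kron-yz m u v (ySlot-isY m m<n j) (zSlot-isY m m<n j) e)) V ⟩
        pair (kron m (λ x → u (base5Weight (y j) ℕ.+ x)) (λ x → v (base5Weight (z j) ℕ.+ x))) V
          ≈⟨ pair-circuit m m≤n
               (λ x → u (base5Weight (y j) ℕ.+ x)) (λ x → v (base5Weight (z j) ℕ.+ x)) ⟩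
        sum {K} (λ i → u (base5Weight (y j) ℕ.+ toℕ i) * v (base5Weight (z j) ℕ.+ toℕ i))
          ≡⟨ ≡.cong₂ (λ p q → sum {K} λ i → u (p ℕ.+ toℕ i) * v (q ℕ.+ toℕ i))
               (ySlot-weight m m<n j) (zSlot-weight m m<n j) ⟩
        sum {K} (λ i → f (toℕ j ℕ.* K ℕ.+ toℕ i)) ∎

  -- The lower bound on the top fan-in.

  module LowerBound (n : ℕ) where

    open Kronecker {n} isYVariable base5Weight
    open Sequences {n} base5Weight
    open Codimension≤

    pair-output : ∀ {k} W (P : Fin k → Poly F n) → (∀ j → pair W (P j) ≈ 0#) →
                  pair W (foldr (_⊕_ F) [] P) ≈ 0#
    pair-output {zero}  W P P≈0 = refl
    pair-output {suc k} W P P≈0 = trans (pair-⊕ W (P zero) _)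
      (trans (+-cong (P≈0 zero) (pair-output W (P ∘ suc) (P≈0 ∘ suc))) (+-identityˡ 0#))

    -- The right-hand side bounds the number of linear equations on `u` that make every product gate
    -- vanish under `kron m (U u) v`. Their only solution is zero, so there are at least as many of
    -- them as the 5^m unknowns.
    topFanIn-bound : ∀ m {q : Poly F n} →
      (∀ u v → pair (kron m u v) q ≈ sum {5 ℕ.^ m} (λ i → u (toℕ i) * v (toℕ i))) →
      (C : ΣΠΣCircuit F n) → ProductDimension≤ F C m → Computes F C q →
      5 ℕ.^ m ≤ ΣΠΣCircuit.topFanIn C ℕ.* 2 ℕ.^ (m ℕ.+ m)
    topFanIn-bound m {q} pair-q C dim≤m C≋q = ℕₚ.≤-trans
      (injective⇒≤ (conditions .matrix) λ u Mu≈0 → u≈0 u (conditions .solutions u Mu≈0))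
      (conditions .equations≤)
      where
      M = 5 ℕ.^ m
      open ΣΠΣCircuit C using (topFanIn; factors; productGate; output)

      U : Vector Carrier M → ℕ → Carrier
      U = at δ

      conditions : Codimension≤ M (topFanIn ℕ.* 2 ℕ.^ (m ℕ.+ m))
                     (λ u → ∀ j v → pair (kron m (U u) v) (productGate j) ≈ 0#)
      conditions = Codimension≤-∀ λ j → gate j (dim≤m j)
        where
        gate : ∀ j → SpanDimension≤ F (factors j) m → Codimension≤ M (2 ℕ.^ (m ℕ.+ m))
                 (λ u → ∀ v → pair (kron m (U u) v) (productGate j) ≈ 0#)
        gate j (d , d≤m , b , basis) = Codimension≤-weaken
          (ℕₚ.^-monoʳ-≤ 2 (ℕₚ.+-monoˡ-≤ m d≤m))
          (λ u A v → pair-kron-product b (factors j) (IsBasisOfSpan.spanning basis) m (U u) v A)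
          (Annihilates-codimension≤ m (yPart ∘ b) δ)

      u≈0 : ∀ u → (∀ j v → pair (kron m (U u) v) (productGate j) ≈ 0#) → ∀ i → u i ≈ 0#
      u≈0 u kills i = begin
        u i                                          ≈⟨ *-identityˡ (u i) ⟨
        1# * u i                                     ≈⟨ *-congʳ (δ-≡ i) ⟨
        δ (toℕ i) i * u i
          ≈⟨ sum-single (λ k → δ (toℕ i) k * u k) i (λ k k≢i → trans
               (*-congʳ (δ-≢ k (k≢i ∘ ≡.sym ∘ Finₚ.toℕ-injective))) (zeroˡ (u k))) ⟨
        U u (toℕ i)                                  ≈⟨ *-identityʳ _ ⟨
        U u (toℕ i) * 1#                             ≈⟨ *-congˡ (δ-≡ i) ⟨
        U u (toℕ i) * v (toℕ i)
          ≈⟨ sum-single (λ k → U u (toℕ k) * v (toℕ k)) i (λ k k≢i → trans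
               (*-congˡ (δ-≢ i (k≢i ∘ Finₚ.toℕ-injective))) (zeroʳ (U u (toℕ k)))) ⟨
        sum {M} (λ k → U u (toℕ k) * v (toℕ k))      ≈⟨ pair-q (U u) v ⟨
        pair (kron m (U u) v) q                      ≈⟨ pair-≋ (kron m (U u) v) {output} {q} C≋q ⟨
        pair (kron m (U u) v) output                 ≈⟨ pair-output _ productGate (λ j → kills j v) ⟩
        0#                                           ∎
        where
        -- Reads off the coefficient of r^i, so the identity matrix returns the entry `u i`.
        v : ℕ → Carrier
        v x = δ x i

-- Numerical estimates.

open import Data.Nat using (_*_; _^_)

^-distribʳ-* : ∀ k m n → (m * n) ^ k ≡ m ^ k * n ^ k
^-distribʳ-* zero    m n = ≡.refl
^-distribʳ-* (suc k) m n = ≡.trans (≡.cong (m * n *_) (^-distribʳ-* k m n))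
                                   (ℕₚ.[m*n]*[o*p]≡[m*o]*[n*p] m n (m ^ k) (n ^ k))

-- The fourth power is enough because 5^4 = 625 exceeds 2 · 4^4 = 512.
exponential-growth : ∀ m s → 5 ^ m ≤ s * 2 ^ (m ℕ.+ m) → 2 ^ m ≤ s ^ 4
exponential-growth m s 5^m≤ = ℕₚ.*-cancelʳ-≤ (2 ^ m) (s ^ 4) (256 ^ m) {{ℕₚ.m^n≢0 256 m}} (begin
  2 ^ m * 256 ^ m              ≡⟨ ^-distribʳ-* m 2 256 ⟨
  512 ^ m                      ≤⟨ ℕₚ.^-monoˡ-≤ m (ℕₚ.m≤m+n 512 113) ⟩
  (5 ^ 4) ^ m                  ≡⟨ ℕₚ.^-*-assoc 5 4 m ⟩
  5 ^ (4 * m)                  ≡⟨ ≡.cong (5 ^_) (ℕₚ.*-comm 4 m) ⟩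
  5 ^ (m * 4)                  ≡⟨ ℕₚ.^-*-assoc 5 m 4 ⟨
  (5 ^ m) ^ 4                  ≤⟨ ℕₚ.^-monoˡ-≤ 4 5^m≤ ⟩
  (s * 2 ^ (m ℕ.+ m)) ^ 4      ≡⟨ ^-distribʳ-* 4 s (2 ^ (m ℕ.+ m)) ⟩
  s ^ 4 * (2 ^ (m ℕ.+ m)) ^ 4  ≡⟨ ≡.cong (s ^ 4 *_) (ℕₚ.^-*-assoc 2 (m ℕ.+ m) 4) ⟩
  s ^ 4 * 2 ^ ((m ℕ.+ m) * 4)  ≡⟨ ≡.cong (λ x → s ^ 4 * 2 ^ x) (8m m) ⟩
  s ^ 4 * 2 ^ (8 * m)          ≡⟨ ≡.cong (s ^ 4 *_) (ℕₚ.^-*-assoc 2 8 m) ⟨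
  s ^ 4 * 256 ^ m              ∎)
  where
  open ℕₚ.≤-Reasoning
  8m : ∀ m → (m ℕ.+ m) * 4 ≡ 8 * m
  8m = solve-∀

-- The remainder is below 10, which is at most 10 (n/10) once n/10 is positive.
n≤n/10*20 : ∀ n → 10 ≤ n → n ≤ n / 10 * 20
n≤n/10*20 n 10≤n = begin
  n                        ≡⟨ DivMod.m≡m%n+[m/n]*n n 10 ⟩
  n % 10 ℕ.+ n / 10 * 10   ≤⟨ ℕₚ.+-monoˡ-≤ (n / 10 * 10) (ℕₚ.<⇒≤ (DivMod.m%n<n n 10)) ⟩
  1 * 10 ℕ.+ n / 10 * 10
    ≤⟨ ℕₚ.+-monoˡ-≤ (n / 10 * 10) (ℕₚ.*-monoˡ-≤ 10 (DivMod./-monoˡ-≤ 10 10≤n)) ⟩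
  n / 10 * 10 ℕ.+ n / 10 * 10 ≡⟨ ℕₚ.*-distribˡ-+ (n / 10) 10 10 ⟨
  n / 10 * 20              ∎
  where open ℕₚ.≤-Reasoning

-- 80 = 4 · 20: a fourth power from `exponential-growth`, a twentieth from replacing n/10 by n.
2^n≤s^80 : ∀ n s → 10 ≤ n → 5 ^ (n / 10) ≤ s * 2 ^ (n / 10 ℕ.+ n / 10) →
           2 ^ (1 * n) ≤ s ^ 80
2^n≤s^80 n s 10≤n 5^m≤ = begin
  2 ^ (1 * n)        ≡⟨ ≡.cong (2 ^_) (ℕₚ.*-identityˡ n) ⟩
  2 ^ n              ≤⟨ ℕₚ.^-monoʳ-≤ 2 (n≤n/10*20 n 10≤n) ⟩
  2 ^ (n / 10 * 20)  ≡⟨ ℕₚ.^-*-assoc 2 (n / 10) 20 ⟨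
  (2 ^ (n / 10)) ^ 20 ≤⟨ ℕₚ.^-monoˡ-≤ 20 (exponential-growth (n / 10) s 5^m≤) ⟩
  (s ^ 4) ^ 20       ≡⟨ ℕₚ.^-*-assoc s 4 20 ⟩
  s ^ 80             ∎
  where open ℕₚ.≤-Reasoning

-- For m = n/10 positive, 22 m ≤ 100 m ≤ (10 m)^2, and 10 m ≤ n.
gates-bound : ∀ n → suc (n / 10 * 22) ≤ n ^ 2 ℕ.+ 2
gates-bound n = begin
  suc (m * 22)             ≤⟨ s≤s (quadratic m) ⟩
  suc (m * 10 * (m * 10))  ≤⟨ s≤s (ℕₚ.*-mono-≤ m*10≤n m*10≤n) ⟩
  suc (n * n)              ≡⟨ ≡.cong (λ x → suc (n * x)) (ℕₚ.*-identityʳ n) ⟨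
  1 ℕ.+ n ^ 2              ≤⟨ ℕₚ.n≤1+n _ ⟩
  2 ℕ.+ n ^ 2              ≡⟨ ℕₚ.+-comm 2 (n ^ 2) ⟩
  n ^ 2 ℕ.+ 2              ∎
  where
  open ℕₚ.≤-Reasoning
  m = n / 10
  m*10≤n = DivMod.m/n*n≤m n 10
  quadratic : ∀ m → m * 22 ≤ m * 10 * (m * 10)
  quadratic zero      = z≤n
  quadratic m@(suc k) = begin
    m * 22            ≤⟨ ℕₚ.*-monoʳ-≤ m (ℕₚ.m≤m+n 22 78) ⟩
    m * (10 * 10)     ≡⟨ ℕₚ.*-assoc m 10 10 ⟨
    m * 10 * 10       ≤⟨ ℕₚ.*-monoʳ-≤ (m * 10) (ℕₚ.m≤m+n 10 (k * 10)) ⟩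
    m * 10 * (m * 10) ∎

n/10*2≤n/2 : ∀ n → n / 10 * 2 ≤ n / 2
n/10*2≤n/2 n = begin
  n / 10 * 2          ≡⟨ DivMod.m*n/n≡m (n / 10 * 2) 2 ⟨
  n / 10 * 2 * 2 / 2  ≤⟨ DivMod./-monoˡ-≤ 2 (begin
    n / 10 * 2 * 2      ≡⟨ ℕₚ.*-assoc (n / 10) 2 2 ⟩
    n / 10 * 4          ≤⟨ ℕₚ.*-monoʳ-≤ (n / 10) (ℕₚ.m≤m+n 4 6) ⟩
    n / 10 * 10         ≤⟨ DivMod.m/n*n≤m n 10 ⟩
    n                   ∎) ⟩
  n / 2               ∎
  where open ℕₚ.≤-Reasoning

-- The explicit polynomial and its properties.

module InnerProducts {c ℓ₁ ℓ₂} (F : HeytingField c ℓ₁ ℓ₂) where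

  open ProductDimension F
  open CommutativeRing
    (HeytingCommutativeRing.commutativeRing (HeytingField.heytingCommutativeRing F))
    using (refl)

  innerProductCircuit : ∀ n → ConstantFreeCircuit (n ℕ.+ 0) (suc (n / 10 * 22))
  innerProductCircuit n = circuit (_↑ˡ 0) (n / 10) (DivMod.m/n*n≤m n 10)

  -- Defined as the value of its own circuit, with an empty bit vector, so that the sum over the
  -- cube {0,1}^0 is `Q n` by computation.
  Q : ∀ n → Poly F n
  Q n = value F (substituteBits F []) (innerProductCircuit n)

  degree-substituteBits : ∀ {n} i → TermsOfDegree≤ 1 (substituteBits F {n} [] i)
  degree-substituteBits {n} i with splitAt n i
  ... | inj₁ t = degree-var t

  degree-Q : ∀ n → DegreeAtMost F (Q n) (n / 2)
  degree-Q n m n/2<m = degreeAtMost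
    (degree-circuit degree-substituteBits (_↑ˡ 0) (n / 10) (DivMod.m/n*n≤m n 10))
    m (ℕₚ.≤-<-trans (n/10*2≤n/2 n) n/2<m)

  explicit-Q : Explicit F Q
  explicit-Q = record
    { exponent      = 2
    ; auxVars       = λ _ → 0
    ; gates         = λ n → n / 10 * 22
    ; circuit       = innerProductCircuit
    ; auxVars≤bound = λ _ → z≤n
    ; gates≤bound   = gates-bound
    ; degree≤bound  = λ n m bound<m → degreeAtMost
        (degree-circuit degree-var (_↑ˡ 0) (n / 10) (DivMod.m/n*n≤m n 10))
        m (ℕₚ.≤-<-trans (ℕₚ.≤-trans (ℕₚ.*-monoʳ-≤ (n / 10) (ℕₚ.m≤m+n 2 20))
                          (ℕₚ.≤-trans (ℕₚ.n≤1+n _) (gates-bound n))) bound<m)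
    ; sums-to       = λ _ _ → refl
    }

  size-bound : ∀ n → 10 ≤ n → (C : ΣΠΣCircuit F n) → ProductDimension≤ F C (n / 10) →
               Computes F C (Q n) → 2 ^ (1 * n) ≤ ΣΠΣCircuit.size C ^ 80
  size-bound n 10≤n C dim C≋Q = 2^n≤s^80 n (ΣΠΣCircuit.size C) 10≤n (ℕₚ.≤-trans
    (LowerBound.topFanIn-bound n m {Q n} pair-Q C dim C≋Q)
    (ℕₚ.*-monoˡ-≤ (2 ^ (m ℕ.+ m)) (ℕₚ.m≤n⇒m≤1+n (ℕₚ.m≤m+n topFanIn bottomGates))))
    where
    open ΣΠΣCircuit C using (topFanIn; bottomGates)
    m = n / 10

    ρι≡var : ∀ t → substituteBits F [] (t ↑ˡ 0) ≡ var F t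
    ρι≡var t rewrite Finₚ.splitAt-↑ˡ n t 0 = ≡.refl

    pair-Q = CircuitPairing.pair-circuit (substituteBits F []) (_↑ˡ 0) ρι≡var
               m (DivMod.m/n*n≤m n 10)

theorem6 : ∀ {c ℓ₁ ℓ₂} (F : HeytingField c ℓ₁ ℓ₂) →
    Σ[ Q ∈ (∀ n → Poly F n) ]
    ( Explicit F Q
    × (∀ n → DegreeAtMost F (Q n) (n / 2))
    × ∃[ p ] ∃[ q ] ∃[ n₀ ]
    ( 0 < p × 0 < q
    × (∀ n → n₀ ≤ n → (C : ΣΠΣCircuit F n) →
    ProductDimension≤ F C (n / 10) →
    Computes F C (Q n) →
    2 ^ (p * n) ≤ ΣΠΣCircuit.size C ^ q)))
-- The size is at least 2^(n/80) from n = 10 on, where the first block of variables fits.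
theorem6 F = Q , explicit-Q , degree-Q , 1 , 80 , 10 , s≤s z≤n , s≤s z≤n , size-bound
  where open InnerProducts F
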